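{- Let $d=n^2$ with $n\in\mathbb Z_{>0}$. Let $\widetilde V_d(\mathbb Z)=\{(a,b,c): b^2-4ac=d,\ b\in\mathbb Z,\ a,c\in\tfrac12\mathbb Z,\ a+c\in\mathbb Z\}$, and let $\Gamma_2=\{\gamma\in\mathrm{SL}_2(\mathbb Z):\gamma \bmod 2\in\{\begin{pmatrix}1&0\\0&1\end{pmatrix},\begin{pmatrix}0&1\\-1&0\end{pmatrix}\}\}$, acting on $\widetilde V_d(\mathbb Z)$ by $(a,b,c)^g=(a,b,c)\iota(g)$. Then a complete set of representatives for the $\Gamma_2$-orbits on $\widetilde V_d(\mathbb Z)$ is $$\{(0,n,0)^{\tau_j}:0\le j<2n\}\cup\{(0,n,0)^{\widetilde\tau_j}:0\le j<2n\},$$ where $\tau_j=\begin{pmatrix}1&j/n\\0&1\end{pmatrix}$ and $\widetilde\tau_j=\begin{pmatrix}1+\frac{j}{2n}&\frac{j}{2n}\\1&1\end{pmatrix}$.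
   Context: The spin morphism is $\iota\begin{pmatrix}a&b\\c&d\end{pmatrix}=\begin{pmatrix}a^2&2ab&b^2\\ac&ad+bc&bd\\c^2&2cd&d^2\end{pmatrix}$, so $(a,b,c)^g$ corresponds to the binary form $Q(x,y)=ax^2+bxy+cy^2$ transformed by $Q^g(v)=Q(vg^t)$. The map $(x,y,z)\mapsto(\frac{z+y}{2},x,\frac{z-y}{2})$ identifies the integer points of $x^2+y^2-z^2=d$ with $\widetilde V_d(\mathbb Z)$, and $\Gamma_2$ preserves $\widetilde V_d(\mathbb Z)$. -}

module Defs where

open import Data.Nat as ℕ using (ℕ; NonZero)
open import Data.Nat.Properties using (m*n≢0)
open import Data.Integer using (ℤ; +_; _+_; _-_; _*_; -_; _/ℕ_)
open import Data.Integer.Divisibility using (_∣_)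
open import Data.Fin using (Fin; toℕ)
open import Data.Bool using (Bool; true; false)
open import Data.Product using (Σ; _×_)
open import Data.Sum using (_⊎_)
open import Relation.Binary.PropositionalEquality using (_≡_)

-- A point (a,b,c) with a,c ∈ ½ℤ, b ∈ ℤ is encoded in DOUBLED outer
-- coordinates:  tri A b C  represents  (a,b,c) = (A/2, b, C/2),  A C ∈ ℤ.
record Tri : Set where
  constructor tri
  field
    A b C : ℤ

-- (a,b,c) ∈ Ṽ_d(ℤ):  a + c ∈ ℤ  (i.e. 2 ∣ A + C)  and  b² - 4ac = d
-- (note 4ac = A C).
InV : ℤ → Tri → Set
InV d (tri A b C) = (+ 2 ∣ A + C) × (b * b - A * C ≡ d)

record M2 : Set where
  constructor mat
  field
    p q r s : ℤ

det : M2 → ℤ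
det (mat p q r s) = p * s - q * r

infix 4 _≡₂_
_≡₂_ : ℤ → ℤ → Set
x ≡₂ y = + 2 ∣ x - y

InΓ₂ : M2 → Set
InΓ₂ g@(mat p q r s) =
  (det g ≡ + 1) ×
  (((p ≡₂ + 1) × (q ≡₂ + 0) × (r ≡₂ + 0) × (s ≡₂ + 1)) ⊎
   ((p ≡₂ + 0) × (q ≡₂ + 1) × (r ≡₂ (- + 1)) × (s ≡₂ + 0)))

-- Right action (a,b,c)^g = (a,b,c) ι(g) with
-- ι[[p,q],[r,s]] = [[p², 2pq, q²], [pr, ps+qr, qs], [r², 2rs, s²]],
-- i.e.  a' = a p² + b p r + c r²,
--       b' = 2a p q + b (p s + q r) + 2c r s,
--       c' = a q² + b q s + c s²,
-- written in the doubled coordinates A = 2a, C = 2c.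
-- (Defined for any integer matrix, no determinant condition.)
act : Tri → M2 → Tri
act (tri A b C) (mat p q r s) =
  tri (A * (p * p) + + 2 * b * (p * r) + C * (r * r))
      (A * (p * q) + b * (p * s + q * r) + C * (r * s))
      (A * (q * q) + + 2 * b * (q * s) + C * (s * s))

_∼_ : Tri → Tri → Set
x ∼ y = Σ M2 λ γ → InΓ₂ γ × (act x γ ≡ y)

divTri : Tri → (k : ℕ) .{{_ : NonZero k}} → Tri
divTri (tri A b C) k = tri (A /ℕ k) (b /ℕ k) (C /ℕ k)

-- Rational matrices are applied as  g = M / D  with M integral;
-- since ι is quadratic,  x^g = x^M / D².  (All divisions below are exact.)
-- τ_j  = [[1, j/n], [0, 1]]                    = [[n, j], [0, n]] / n
-- τ̃_j = [[1 + j/(2n), j/(2n)], [1, 1]]         = [[2n+j, j], [2n, 2n]] / (2n)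
τM : ℕ → ℕ → M2
τM n j = mat (+ n) (+ j) (+ 0) (+ n)

τ̃M : ℕ → ℕ → M2
τ̃M n j = mat (+ (2 ℕ.* n ℕ.+ j)) (+ j) (+ (2 ℕ.* n)) (+ (2 ℕ.* n))

base : ℕ → Tri
base n = tri (+ 0) (+ n) (+ 0)

rep : (n : ℕ) .{{_ : NonZero n}} → Bool → Fin (2 ℕ.* n) → Tri
rep n false j = divTri (act (base n) (τM n (toℕ j))) (n ℕ.* n) {{m*n≢0 n n}}
rep n true  j = divTri (act (base n) (τ̃M n (toℕ j))) ((2 ℕ.* n) ℕ.* (2 ℕ.* n))
                  {{m*n≢0 (2 ℕ.* n) (2 ℕ.* n) {{m*n≢0 2 n}} {{m*n≢0 2 n}}}}

module Submission where

-- Put N = n and Z c = (0, N, c/2); the representatives are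
-- (0,n,0)^{τ_j} = Z(2j) and (0,n,0)^{τ̃_j} = (Z j)^H with H = [[1,0],[1,1]].
--
-- Translations T u act by Z c ↦ Z(c + 2Nu), and
--   H⁻¹ T(u) H = γ(u) lies in Γ₂ for every u.
-- * Existence: for x ∈ Ṽ_{n²} the matrix [[A, b+N], [b-N, C]] is singular,
--   and x ↦ x^g carries its kernel vector w to g⁻¹w.  A Euclid-type descent
--   on |w₁| + 2|w₂| with S⁻¹, T(±2) ∈ Γ₂ reaches w = (u,0) or (-v,v); there
--   x = Z c with c even, resp. x = (Z c)^H, and a translation reduces c
--   modulo 4N, resp. 2N.
-- * Uniqueness: a determinant-one matrix carrying Z c to Z c′ is ±T(u), so
--   c′ = c ± 2Nu; the parity pattern of Γ₂ forces u even inside the first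
--   family and rules out any matrix relating the two families.

open import Defs
open import Data.Nat as ℕ using (ℕ; NonZero; zero; suc; s≤s; z≤n)
import Data.Nat.Properties as ℕP
import Data.Nat.Tactic.RingSolver as ℕ-Ring
import Data.Nat.DivMod as ℕD
open import Data.Nat.Divisibility using (divides)
open import Data.Integer using (ℤ; +_; -[1+_]; +[1+_]; _+_; _-_; _*_; -_; ∣_∣; _/ℕ_; _%ℕ_; _⊖_)
import Data.Integer.Properties as ℤP
import Data.Integer.DivMod as ℤD
import Data.Integer.Divisibility.Signed as ℤS
open import Data.Integer.Tactic.RingSolver using (solve-∀)
open import Data.Fin using (Fin; toℕ; fromℕ<)
import Data.Fin.Properties as FinP
open import Data.Bool using (Bool; true; false)
open import Data.Product using (Σ; _×_; _,_; proj₁; proj₂)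
open import Data.Product.Properties using (≡-dec)
open import Data.Sum using (_⊎_; inj₁; inj₂)
open import Data.Empty using (⊥; ⊥-elim)
open import Function using (_$_)
open import Relation.Nullary using (¬_; yes; no)
open import Relation.Binary.Definitions using (tri<; tri≈; tri>)
open import Relation.Binary.PropositionalEquality
  using (_≡_; _≢_; refl; sym; trans; cong; cong₂; subst; subst₂; module ≡-Reasoning)

-- Integer matrices, the action and the determinant

infixl 7 _∙_
_∙_ : M2 → M2 → M2
mat p q r s ∙ mat p′ q′ r′ s′ =
  mat (p * p′ + q * r′) (p * q′ + q * s′) (r * p′ + s * r′) (r * q′ + s * s′)

I₂ : M2
I₂ = mat (+ 1) (+ 0) (+ 0) (+ 1)

cong₃ : ∀ {A B C D : Set} (f : A → B → C → D) {a a′ b b′ c c′} →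
  a ≡ a′ → b ≡ b′ → c ≡ c′ → f a b c ≡ f a′ b′ c′
cong₃ f refl refl refl = refl

-- act is a right action of the multiplicative monoid of integer matrices:
-- x^(gh) = (x^g)^h, because ι is multiplicative.
act-∙ : ∀ x g h → act x (g ∙ h) ≡ act (act x g) h
act-∙ (tri A b C) (mat p q r s) (mat p′ q′ r′ s′) =
  cong₃ tri (eA A b C p q r s p′ q′ r′ s′) (eb A b C p q r s p′ q′ r′ s′) (eC A b C p q r s p′ q′ r′ s′)
  where
  eA : ∀ A b C p q r s p′ q′ r′ s′ →
    A * ((p * p′ + q * r′) * (p * p′ + q * r′)) + + 2 * b * ((p * p′ + q * r′) * (r * p′ + s * r′))
      + C * ((r * p′ + s * r′) * (r * p′ + s * r′))
    ≡ (A * (p * p) + + 2 * b * (p * r) + C * (r * r)) * (p′ * p′)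
      + + 2 * (A * (p * q) + b * (p * s + q * r) + C * (r * s)) * (p′ * r′)
      + (A * (q * q) + + 2 * b * (q * s) + C * (s * s)) * (r′ * r′)
  eA = solve-∀
  eb : ∀ A b C p q r s p′ q′ r′ s′ →
    A * ((p * p′ + q * r′) * (p * q′ + q * s′))
      + b * ((p * p′ + q * r′) * (r * q′ + s * s′) + (p * q′ + q * s′) * (r * p′ + s * r′))
      + C * ((r * p′ + s * r′) * (r * q′ + s * s′))
    ≡ (A * (p * p) + + 2 * b * (p * r) + C * (r * r)) * (p′ * q′)
      + (A * (p * q) + b * (p * s + q * r) + C * (r * s)) * (p′ * s′ + q′ * r′)
      + (A * (q * q) + + 2 * b * (q * s) + C * (s * s)) * (r′ * s′)
  eb = solve-∀
  eC : ∀ A b C p q r s p′ q′ r′ s′ →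
    A * ((p * q′ + q * s′) * (p * q′ + q * s′)) + + 2 * b * ((p * q′ + q * s′) * (r * q′ + s * s′))
      + C * ((r * q′ + s * s′) * (r * q′ + s * s′))
    ≡ (A * (p * p) + + 2 * b * (p * r) + C * (r * r)) * (q′ * q′)
      + + 2 * (A * (p * q) + b * (p * s + q * r) + C * (r * s)) * (q′ * s′)
      + (A * (q * q) + + 2 * b * (q * s) + C * (s * s)) * (s′ * s′)
  eC = solve-∀

act-I₂ : ∀ x → act x I₂ ≡ x
act-I₂ (tri A b C) = cong₃ tri (eA A b C) (eb A b C) (eC A b C)
  where
  eA : ∀ A b C → A * (+ 1 * + 1) + + 2 * b * (+ 1 * + 0) + C * (+ 0 * + 0) ≡ A
  eA = solve-∀
  eb : ∀ A b C → A * (+ 1 * + 0) + b * (+ 1 * + 1 + + 0 * + 0) + C * (+ 0 * + 1) ≡ b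
  eb = solve-∀
  eC : ∀ A b C → A * (+ 0 * + 0) + + 2 * b * (+ 0 * + 1) + C * (+ 1 * + 1) ≡ C
  eC = solve-∀

det-∙ : ∀ g h → det (g ∙ h) ≡ det g * det h
det-∙ (mat p q r s) (mat p′ q′ r′ s′) = e p q r s p′ q′ r′ s′
  where
  e : ∀ p q r s p′ q′ r′ s′ →
    (p * p′ + q * r′) * (r * q′ + s * s′) - (p * q′ + q * s′) * (r * p′ + s * r′)
    ≡ (p * s - q * r) * (p′ * s′ - q′ * r′)
  e = solve-∀

-- Congruence modulo 2, phrased with signed divisibility so that it is
-- compatible with +, * and - (the record makes both sides inferable).

infix 4 _≈₂_
record _≈₂_ (x y : ℤ) : Set where
  constructor ≈₂-intro
  field 2∣x-y : + 2 ℤS.∣ x - y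

Odd : ℤ → Set
Odd x = ¬ (x ≈₂ + 0)

≈₂-reflexive : ∀ {x y} → x ≡ y → x ≈₂ y
≈₂-reflexive {x} refl = ≈₂-intro (ℤS.divides (+ 0) (ℤP.+-inverseʳ x))

≈₂-sym : ∀ {x y} → x ≈₂ y → y ≈₂ x
≈₂-sym {x} {y} (≈₂-intro d) = ≈₂-intro (subst (+ 2 ℤS.∣_) (flip x y) (ℤS.∣m⇒∣-m d))
  where
  flip : ∀ x y → - (x - y) ≡ y - x
  flip = solve-∀

≈₂-trans : ∀ {x y z} → x ≈₂ y → y ≈₂ z → x ≈₂ z
≈₂-trans {x} {y} {z} (≈₂-intro d) (≈₂-intro e) =
  ≈₂-intro (subst (+ 2 ℤS.∣_) (telescope x y z) (ℤS.∣m∣n⇒∣m+n d e))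
  where
  telescope : ∀ x y z → (x - y) + (y - z) ≡ x - z
  telescope = solve-∀

≈₂-+ : ∀ {x x′ y y′} → x ≈₂ x′ → y ≈₂ y′ → x + y ≈₂ x′ + y′
≈₂-+ {x} {x′} {y} {y′} (≈₂-intro d) (≈₂-intro e) =
  ≈₂-intro (subst (+ 2 ℤS.∣_) (regroup x x′ y y′) (ℤS.∣m∣n⇒∣m+n d e))
  where
  regroup : ∀ x x′ y y′ → (x - x′) + (y - y′) ≡ (x + y) - (x′ + y′)
  regroup = solve-∀

≈₂-* : ∀ {x x′ y y′} → x ≈₂ x′ → y ≈₂ y′ → x * y ≈₂ x′ * y′
≈₂-* {x} {x′} {y} {y′} (≈₂-intro d) (≈₂-intro e) =
  ≈₂-intro (subst (+ 2 ℤS.∣_) (regroup x x′ y y′) (ℤS.∣m∣n⇒∣m+n (ℤS.∣m⇒∣m*n y d) (ℤS.∣n⇒∣m*n x′ e)))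
  where
  regroup : ∀ x x′ y y′ → (x - x′) * y + x′ * (y - y′) ≡ x * y - x′ * y′
  regroup = solve-∀

≈₂-neg : ∀ {x y} → x ≈₂ y → - x ≈₂ - y
≈₂-neg {x} {y} (≈₂-intro d) = ≈₂-intro (subst (+ 2 ℤS.∣_) (regroup x y) (ℤS.∣m⇒∣-m d))
  where
  regroup : ∀ x y → - (x - y) ≡ - x - - y
  regroup = solve-∀

≈₂-+ˡ : ∀ k {y y′} → y ≈₂ y′ → k + y ≈₂ k + y′
≈₂-+ˡ k = ≈₂-+ (≈₂-reflexive {k} refl)

≈₂-*ˡ : ∀ k {y y′} → y ≈₂ y′ → k * y ≈₂ k * y′
≈₂-*ˡ k = ≈₂-* (≈₂-reflexive {k} refl)

2≈₂0 : + 2 ≈₂ + 0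
2≈₂0 = ≈₂-intro (ℤS.divides (+ 1) refl)

even : ∀ t → + 2 * t ≈₂ + 0
even t = ≈₂-intro (ℤS.divides t (e t))
  where
  e : ∀ t → + 2 * t - + 0 ≡ t * + 2
  e = solve-∀

1-odd : Odd (+ 1)
1-odd (≈₂-intro d) with ℤS.∣⇒∣ᵤ d
... | divides zero ()
... | divides (suc _) ()

-1-odd : Odd (- + 1)
-1-odd e = 1-odd (≈₂-neg e)

≈₂-remainder : ∀ {x} r t → x ≡ r + t * + 2 → x ≈₂ r
≈₂-remainder r t refl = ≈₂-intro (ℤS.divides t (e r t))
  where
  e : ∀ r t → r + t * + 2 - r ≡ t * + 2
  e = solve-∀

parity : ∀ x → x ≈₂ + 0 ⊎ x ≈₂ + 1
parity x with x %ℕ 2 | ℤD.a≡a%ℕn+[a/ℕn]*n x 2 | ℤD.n%ℕd<d x 2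
... | 0           | x≡ | _ = inj₁ (≈₂-remainder (+ 0) (x /ℕ 2) x≡)
... | 1           | x≡ | _ = inj₂ (≈₂-remainder (+ 1) (x /ℕ 2) x≡)
... | suc (suc _) | _  | s≤s (s≤s ())

-- The group Γ₂

data Γ₂-class : M2 → Set where
  class-I : ∀ {p q r s} → p ≈₂ + 1 → q ≈₂ + 0 → r ≈₂ + 0 → s ≈₂ + 1 → Γ₂-class (mat p q r s)
  class-S : ∀ {p q r s} → p ≈₂ + 0 → q ≈₂ + 1 → r ≈₂ - + 1 → s ≈₂ + 0 → Γ₂-class (mat p q r s)

Γ₂-class-of : ∀ g → InΓ₂ g → Γ₂-class g
Γ₂-class-of (mat _ _ _ _) (_ , inj₁ (p , q , r , s)) =
  class-I (≈₂-intro (ℤS.∣ᵤ⇒∣ p)) (≈₂-intro (ℤS.∣ᵤ⇒∣ q)) (≈₂-intro (ℤS.∣ᵤ⇒∣ r)) (≈₂-intro (ℤS.∣ᵤ⇒∣ s))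
Γ₂-class-of (mat _ _ _ _) (_ , inj₂ (p , q , r , s)) =
  class-S (≈₂-intro (ℤS.∣ᵤ⇒∣ p)) (≈₂-intro (ℤS.∣ᵤ⇒∣ q)) (≈₂-intro (ℤS.∣ᵤ⇒∣ r)) (≈₂-intro (ℤS.∣ᵤ⇒∣ s))

in-Γ₂ : ∀ g → det g ≡ + 1 → Γ₂-class g → InΓ₂ g
in-Γ₂ (mat _ _ _ _) d (class-I (≈₂-intro p) (≈₂-intro q) (≈₂-intro r) (≈₂-intro s)) =
  d , inj₁ (ℤS.∣⇒∣ᵤ p , ℤS.∣⇒∣ᵤ q , ℤS.∣⇒∣ᵤ r , ℤS.∣⇒∣ᵤ s)
in-Γ₂ (mat _ _ _ _) d (class-S (≈₂-intro p) (≈₂-intro q) (≈₂-intro r) (≈₂-intro s)) =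
  d , inj₂ (ℤS.∣⇒∣ᵤ p , ℤS.∣⇒∣ᵤ q , ℤS.∣⇒∣ᵤ r , ℤS.∣⇒∣ᵤ s)

-- The classes multiply like the group {I, S} modulo 2 (S² = -I ≡ I).
Γ₂-class-∙ : ∀ {g h} → Γ₂-class g → Γ₂-class h → Γ₂-class (g ∙ h)
Γ₂-class-∙ (class-I p q r s) (class-I p′ q′ r′ s′) =
  class-I (≈₂-+ (≈₂-* p p′) (≈₂-* q r′)) (≈₂-+ (≈₂-* p q′) (≈₂-* q s′))
          (≈₂-+ (≈₂-* r p′) (≈₂-* s r′)) (≈₂-+ (≈₂-* r q′) (≈₂-* s s′))
Γ₂-class-∙ (class-I p q r s) (class-S p′ q′ r′ s′) =
  class-S (≈₂-+ (≈₂-* p p′) (≈₂-* q r′)) (≈₂-+ (≈₂-* p q′) (≈₂-* q s′))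
          (≈₂-+ (≈₂-* r p′) (≈₂-* s r′)) (≈₂-+ (≈₂-* r q′) (≈₂-* s s′))
Γ₂-class-∙ (class-S p q r s) (class-I p′ q′ r′ s′) =
  class-S (≈₂-+ (≈₂-* p p′) (≈₂-* q r′)) (≈₂-+ (≈₂-* p q′) (≈₂-* q s′))
          (≈₂-+ (≈₂-* r p′) (≈₂-* s r′)) (≈₂-+ (≈₂-* r q′) (≈₂-* s s′))
Γ₂-class-∙ (class-S p q r s) (class-S p′ q′ r′ s′) =
  class-I (≈₂-trans (≈₂-+ (≈₂-* p p′) (≈₂-* q r′)) -1≈₂1) (≈₂-+ (≈₂-* p q′) (≈₂-* q s′))
          (≈₂-+ (≈₂-* r p′) (≈₂-* s r′)) (≈₂-trans (≈₂-+ (≈₂-* r q′) (≈₂-* s s′)) -1≈₂1)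
  where
  -1≈₂1 : - + 1 ≈₂ + 1
  -1≈₂1 = ≈₂-intro (ℤS.divides (- + 1) refl)

Γ₂-∙ : ∀ g h → InΓ₂ g → InΓ₂ h → InΓ₂ (g ∙ h)
Γ₂-∙ g h γg γh = in-Γ₂ (g ∙ h) (trans (det-∙ g h) (cong₂ _*_ (proj₁ γg) (proj₁ γh)))
                         (Γ₂-class-∙ (Γ₂-class-of g γg) (Γ₂-class-of h γh))

∼-trans : ∀ {x y z} → x ∼ y → y ∼ z → x ∼ z
∼-trans {x} (g , γg , x^g≡y) (h , γh , y^h≡z) =
  g ∙ h , Γ₂-∙ g h γg γh , trans (act-∙ x g h) (trans (cong (λ t → act t h) x^g≡y) y^h≡z)

Γ₂-r-even : ∀ p q r s → InΓ₂ (mat p q r s) → r ≈₂ + 0 → q ≈₂ + 0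
Γ₂-r-even p q r s γ r≈0 with Γ₂-class-of (mat p q r s) γ
... | class-I _ q _ _ = q
... | class-S _ _ r _ = ⊥-elim (-1-odd (≈₂-trans (≈₂-sym r) r≈0))

Γ₂-r-odd : ∀ p q r s → InΓ₂ (mat p q r s) → Odd r → (p ≈₂ + 0) × (s ≈₂ + 0)
Γ₂-r-odd p q r s γ r-odd with Γ₂-class-of (mat p q r s) γ
... | class-I _ _ r _ = ⊥-elim (r-odd r)
... | class-S p _ _ s = p , s

-- Γ₂ preserves the condition a + c ∈ ℤ, i.e. 2 ∣ A + C: modulo 2 every
-- Γ₂-matrix acts on A + C like I or S = [[0,1],[-1,0]], and both leave A + C unchanged.
sumAC : Tri → ℤ
sumAC (tri A _ C) = A + C

Par : Tri → Set
Par x = sumAC x ≈₂ + 0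

sumAC-mod₂ : ∀ x {p q r s p₀ q₀ r₀ s₀} → p ≈₂ p₀ → q ≈₂ q₀ → r ≈₂ r₀ → s ≈₂ s₀ →
  sumAC (act x (mat p q r s)) ≈₂ sumAC (act x (mat p₀ q₀ r₀ s₀))
sumAC-mod₂ (tri A b C) p q r s =
  ≈₂-+ (≈₂-+ (≈₂-+ (≈₂-*ˡ A (≈₂-* p p)) (≈₂-*ˡ (+ 2 * b) (≈₂-* p r))) (≈₂-*ˡ C (≈₂-* r r)))
       (≈₂-+ (≈₂-+ (≈₂-*ˡ A (≈₂-* q q)) (≈₂-*ˡ (+ 2 * b) (≈₂-* q s))) (≈₂-*ˡ C (≈₂-* s s)))

sumAC-S : ∀ x → sumAC (act x (mat (+ 0) (+ 1) (- + 1) (+ 0))) ≡ sumAC x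
sumAC-S (tri A b C) = e A b C
  where
  e : ∀ A b C → A * (+ 0 * + 0) + + 2 * b * (+ 0 * - + 1) + C * (- + 1 * - + 1)
                + (A * (+ 1 * + 1) + + 2 * b * (+ 1 * + 0) + C * (+ 0 * + 0)) ≡ A + C
  e = solve-∀

Par-act : ∀ x g → InΓ₂ g → Par x → Par (act x g)
Par-act x g γ par with Γ₂-class-of g γ
... | class-I p q r s = ≈₂-trans (sumAC-mod₂ x p q r s) (subst (_≈₂ + 0) (sym (cong sumAC (act-I₂ x))) par)
... | class-S p q r s = ≈₂-trans (sumAC-mod₂ x p q r s) (subst (_≈₂ + 0) (sym (sumAC-S x)) par)

T : ℤ → M2
T u = mat (+ 1) u (+ 0) (+ 1)

det-T : ∀ u → det (T u) ≡ + 1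
det-T u = e u
  where
  e : ∀ u → + 1 * + 1 - u * + 0 ≡ + 1
  e = solve-∀

T-Γ₂ : ∀ u → u ≈₂ + 0 → InΓ₂ (T u)
T-Γ₂ u u≈0 = in-Γ₂ (T u) (det-T u) (class-I (≈₂-reflexive refl) u≈0 (≈₂-reflexive refl) (≈₂-reflexive refl))

S⁻¹ : M2
S⁻¹ = mat (+ 0) (- + 1) (+ 1) (+ 0)

S⁻¹-Γ₂ : InΓ₂ S⁻¹
S⁻¹-Γ₂ = in-Γ₂ S⁻¹ refl (class-S (≈₂-reflexive refl) (≈₂-intro (ℤS.divides (- + 1) refl))
                              (≈₂-intro (ℤS.divides (+ 1) refl)) (≈₂-reflexive refl))

-- H = [[1,0],[1,1]] is not in Γ₂, but conjugation by H carries every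
-- translation into Γ₂:  H γ(u) = T(u) H  with γ(u) ∈ Γ₂.
H H⁻¹ : M2
H = mat (+ 1) (+ 0) (+ 1) (+ 1)
H⁻¹ = mat (+ 1) (+ 0) (- + 1) (+ 1)

act-H-H⁻¹ : ∀ x → act (act x H) H⁻¹ ≡ x
act-H-H⁻¹ x = trans (sym (act-∙ x H H⁻¹)) (act-I₂ x)

γ : ℤ → M2
γ u = mat (+ 1 + u) u (- u) (+ 1 - u)

mat-≡ : ∀ {p p′ q q′ r r′ s s′} → p ≡ p′ → q ≡ q′ → r ≡ r′ → s ≡ s′ → mat p q r s ≡ mat p′ q′ r′ s′
mat-≡ refl refl refl refl = refl

H∙γ : ∀ u → H ∙ γ u ≡ T u ∙ H
H∙γ u = mat-≡ (e₁ u) (e₂ u) (e₃ u) (e₄ u)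
  where
  e₁ : ∀ u → + 1 * (+ 1 + u) + + 0 * (- u) ≡ + 1 * + 1 + u * + 1
  e₁ = solve-∀
  e₂ : ∀ u → + 1 * u + + 0 * (+ 1 - u) ≡ + 1 * + 0 + u * + 1
  e₂ = solve-∀
  e₃ : ∀ u → + 1 * (+ 1 + u) + + 1 * (- u) ≡ + 1
  e₃ = solve-∀
  e₄ : ∀ u → + 1 * u + + 1 * (+ 1 - u) ≡ + 1
  e₄ = solve-∀

γ-Γ₂ : ∀ u → InΓ₂ (γ u)
γ-Γ₂ u = in-Γ₂ (γ u) (det-γ u) (class (parity u))
  where
  det-γ : ∀ u → (+ 1 + u) * (+ 1 - u) - u * (- u) ≡ + 1
  det-γ = solve-∀
  class : u ≈₂ + 0 ⊎ u ≈₂ + 1 → Γ₂-class (γ u)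
  class (inj₁ u≈0) = class-I (≈₂-+ˡ (+ 1) u≈0) u≈0 (≈₂-neg u≈0) (≈₂-+ˡ (+ 1) (≈₂-neg u≈0))
  class (inj₂ u≈1) = class-S (≈₂-trans (≈₂-+ˡ (+ 1) u≈1) 2≈₂0) u≈1 (≈₂-neg u≈1)
                             (≈₂-+ˡ (+ 1) (≈₂-neg u≈1))

-- Column vectors and the Euclid-type descent

ℤ² : Set
ℤ² = ℤ × ℤ

infixr 6 _⊙_
_⊙_ : M2 → ℤ² → ℤ²
mat p q r s ⊙ (u , v) = (p * u + q * v , r * u + s * v)

⊙-zero : ∀ g → g ⊙ (+ 0 , + 0) ≡ (+ 0 , + 0)
⊙-zero (mat p q r s) = cong₂ _,_ (e p q) (e r s)
  where
  e : ∀ p q → p * + 0 + q * + 0 ≡ + 0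
  e = solve-∀

S⁻¹-⊙ : ∀ u v → S⁻¹ ⊙ (v , - u) ≡ (u , v)
S⁻¹-⊙ u v = cong₂ _,_ (e₁ u v) (e₂ u v)
  where
  e₁ : ∀ u v → + 0 * v + - + 1 * - u ≡ u
  e₁ = solve-∀
  e₂ : ∀ u v → + 1 * v + + 0 * - u ≡ v
  e₂ = solve-∀

T-⊙ : ∀ t u v → T t ⊙ (u - t * v , v) ≡ (u , v)
T-⊙ t u v = cong₂ _,_ (e₁ t u v) (e₂ (u - t * v) v)
  where
  e₁ : ∀ t u v → + 1 * (u - t * v) + t * v ≡ u
  e₁ = solve-∀
  e₂ : ∀ w v → + 0 * w + + 1 * v ≡ v
  e₂ = solve-∀

-- The quantity decreased by the descent.
size : ℤ² → ℕ
size (u , v) = ∣ u ∣ ℕ.+ 2 ℕ.* ∣ v ∣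

size-neg : ∀ u v → size (- u , v) ≡ size (u , v)
size-neg u v = cong (ℕ._+ 2 ℕ.* ∣ v ∣) (ℤP.∣-i∣≡∣i∣ u)

swap-shrinks : ∀ u v → ∣ u ∣ ℕ.< ∣ v ∣ → size (v , - u) ℕ.< size (u , v)
swap-shrinks u v lt rewrite ℤP.∣-i∣≡∣i∣ u =
  subst₂ ℕ._<_ (e₁ ∣ u ∣ ∣ v ∣) (e₂ ∣ u ∣ ∣ v ∣) (ℕP.+-monoʳ-< (∣ u ∣ ℕ.+ ∣ v ∣) lt)
  where
  e₁ : ∀ a b → a ℕ.+ b ℕ.+ a ≡ b ℕ.+ 2 ℕ.* a
  e₁ = ℕ-Ring.solve-∀
  e₂ : ∀ a b → a ℕ.+ b ℕ.+ b ≡ a ℕ.+ 2 ℕ.* b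
  e₂ = ℕ-Ring.solve-∀

∣a⊖2b∣<a : ∀ a b → 0 ℕ.< b → b ℕ.< a → ∣ a ⊖ 2 ℕ.* b ∣ ℕ.< a
∣a⊖2b∣<a a@(suc _) b 0<b b<a with 2 ℕ.* b ℕP.≤? a
... | yes 2b≤a rewrite ℤP.⊖-≥ 2b≤a = ℕP.m<n+o⇒m∸n<o a (2 ℕ.* b) (ℕP.m<n+m a (ℕP.*-monoʳ-< 2 0<b))
... | no 2b≰a rewrite ℤP.∣⊖∣-≰ 2b≰a =
  ℕP.m<n+o⇒m∸n<o (2 ℕ.* b) a (subst (2 ℕ.* b ℕ.<_) (cong (a ℕ.+_) (ℕP.+-identityʳ a)) (ℕP.*-monoʳ-< 2 b<a))

a-2b≡a⊖2b : ∀ a b → + a - + 2 * + b ≡ a ⊖ 2 ℕ.* b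
a-2b≡a⊖2b a b = trans (cong (λ t → + a - t) (sym (ℤP.pos-* 2 b))) (ℤP.m-n≡m⊖n a (2 ℕ.* b))

shift-shrinks : ∀ a b → 0 ℕ.< b → b ℕ.< a → size (+ a - + 2 * + b , + b) ℕ.< size (+ a , + b)
shift-shrinks a b 0<b b<a =
  ℕP.+-monoˡ-< (2 ℕ.* b) (subst (λ z → ∣ z ∣ ℕ.< a) (sym (a-2b≡a⊖2b a b)) (∣a⊖2b∣<a a b 0<b b<a))

data Terminal : ℤ² → Set where
  horizontal   : ∀ {u} → u ≢ + 0 → Terminal (u , + 0)
  antidiagonal : ∀ {v} → v ≢ + 0 → Terminal (- v , v)

record Reduction (w : ℤ²) : Set where
  constructor reduction
  field
    g        : M2
    g∈Γ₂     : InΓ₂ g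
    w′       : ℤ²
    g⊙w′     : g ⊙ w′ ≡ w
    progress : Terminal w′ ⊎ size w′ ℕ.< size w

reduce⁺ : ∀ u m → Terminal (u , + suc m) ⊎ Reduction (u , + suc m)
reduce⁺ (+ a) m with ℕP.<-cmp a (suc m)
... | tri< a<v _ _ =
  inj₂ (reduction S⁻¹ S⁻¹-Γ₂ (+ suc m , - + a) (S⁻¹-⊙ (+ a) (+ suc m))
         (inj₂ (swap-shrinks (+ a) (+ suc m) a<v)))
... | tri≈ _ refl _ =
  inj₂ (reduction (T (+ 2)) (T-Γ₂ (+ 2) 2≈₂0) (+ a - + 2 * + a , + a) (T-⊙ (+ 2) (+ a) (+ a))
         (inj₁ (subst (λ z → Terminal (z , + a)) (sym (v-2v≡-v (+ a))) (antidiagonal (λ ())))))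
  where
  v-2v≡-v : ∀ v → v - + 2 * v ≡ - v
  v-2v≡-v = solve-∀
... | tri> _ _ v<a =
  inj₂ (reduction (T (+ 2)) (T-Γ₂ (+ 2) 2≈₂0) (+ a - + 2 * + suc m , + suc m) (T-⊙ (+ 2) (+ a) (+ suc m))
         (inj₂ (shift-shrinks a (suc m) (s≤s z≤n) v<a)))
reduce⁺ -[1+ a ] m with ℕP.<-cmp a m
... | tri< a<m _ _ =
  inj₂ (reduction S⁻¹ S⁻¹-Γ₂ (+ suc m , + suc a) (S⁻¹-⊙ -[1+ a ] (+ suc m))
         (inj₂ (swap-shrinks -[1+ a ] (+ suc m) (s≤s a<m))))
... | tri≈ _ refl _ = inj₁ (antidiagonal (λ ()))
... | tri> _ _ m<a =
  inj₂ (reduction (T (- + 2)) (T-Γ₂ (- + 2) (≈₂-neg 2≈₂0)) (-[1+ a ] - - + 2 * + suc m , + suc m)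
         (T-⊙ (- + 2) -[1+ a ] (+ suc m)) (inj₂ shrinks))
  where
  reflect : ∀ u v → - u - - + 2 * v ≡ - (u - + 2 * v)
  reflect = solve-∀
  shrinks : size (-[1+ a ] - - + 2 * + suc m , + suc m) ℕ.< size (-[1+ a ] , + suc m)
  shrinks rewrite reflect (+ suc a) (+ suc m) | size-neg (+ suc a - + 2 * + suc m) (+ suc m) =
    shift-shrinks (suc a) (suc m) (s≤s z≤n) (s≤s m<a)

-- Cancellation, units, residues and exact division in ℤ

cancel-nonzero : ∀ {x u} → u ≢ + 0 → x * u ≡ + 0 → x ≡ + 0
cancel-nonzero {x} u≢0 xu≡0 with ℤP.i*j≡0⇒i≡0∨j≡0 x xu≡0
... | inj₁ x≡0 = x≡0
... | inj₂ u≡0 = ⊥-elim (u≢0 u≡0)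

IsUnit : ℤ → Set
IsUnit x = x ≡ + 1 ⊎ x ≡ - + 1

unit-factors : ∀ p s → p * s ≡ + 1 → IsUnit p × IsUnit s
unit-factors p s ps≡1 = unit (ℕP.m*n≡1⇒m≡1 ∣ p ∣ ∣ s ∣ abs≡1) , unit (ℕP.m*n≡1⇒n≡1 ∣ p ∣ ∣ s ∣ abs≡1)
  where
  abs≡1 : ∣ p ∣ ℕ.* ∣ s ∣ ≡ 1
  abs≡1 = trans (sym (ℤP.abs-* p s)) (cong ∣_∣ ps≡1)
  unit : ∀ {x} → ∣ x ∣ ≡ 1 → IsUnit x
  unit {+ .1} refl = inj₁ refl
  unit { -[1+ zero ] } refl = inj₂ refl

unit-square : ∀ {x} → IsUnit x → x * x ≡ + 1
unit-square (inj₁ refl) = refl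
unit-square (inj₂ refl) = refl

unit-neg : ∀ {x} → IsUnit x → IsUnit (- x)
unit-neg (inj₁ refl) = inj₂ refl
unit-neg (inj₂ refl) = inj₁ refl

unit-odd : ∀ {x} → IsUnit x → Odd x
unit-odd (inj₁ refl) = 1-odd
unit-odd (inj₂ refl) = -1-odd

modulus≤ : ∀ a a′ D k → + a′ ≡ + a + + D * + suc k → D ℕ.≤ a′
modulus≤ a a′ D k e = subst (D ℕ.≤_) (sym a′≡) (ℕP.≤-trans (ℕP.m≤m*n D (suc k)) (ℕP.m≤n+m _ a))
  where
  a′≡ : a′ ≡ a ℕ.+ D ℕ.* suc k
  a′≡ = ℤP.+-injective (trans e (trans (cong (λ z → + a + z) (sym (ℤP.pos-* D (suc k))))
                                       (sym (ℤP.pos-+ a (D ℕ.* suc k)))))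

residue-unique : ∀ {a a′ D} → a ℕ.< D → a′ ℕ.< D → ∀ t → + a′ ≡ + a + + D * t → a′ ≡ a
residue-unique {a} {a′} {D} _ _ (+ zero) e =
  ℤP.+-injective (trans e (trans (cong (λ z → + a + z) (ℤP.*-zeroʳ (+ D))) (ℤP.+-identityʳ (+ a))))
residue-unique {a} {a′} {D} _ a′<D +[1+ k ] e = ⊥-elim (ℕP.<⇒≱ a′<D (modulus≤ a a′ D k e))
residue-unique {a} {a′} {D} a<D _ -[1+ k ] e =
  ⊥-elim (ℕP.<⇒≱ a<D (modulus≤ a′ a D k (flip (+ a) (+ a′) (+ D) (+ suc k) e)))
  where
  flip : ∀ a a′ D K → a′ ≡ a + D * (- K) → a ≡ a′ + D * K
  flip a .(a + D * (- K)) D K refl = undo a D K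
    where
    undo : ∀ a D K → a ≡ (a + D * (- K)) + D * K
    undo = solve-∀

/ℕ-exact : ∀ {z} m d .{{_ : NonZero d}} → z ≡ + m * + d → z /ℕ d ≡ + m
/ℕ-exact m d refl rewrite sym (ℤP.pos-* m d) = cong +_ (ℕD.m*n/n≡m m d)

divTri-exact : ∀ x k .{{_ : NonZero k}} a b c →
  x ≡ tri (+ a * + k) (+ b * + k) (+ c * + k) → divTri x k ≡ tri (+ a) (+ b) (+ c)
divTri-exact x k a b c refl = cong₃ tri (/ℕ-exact a k refl) (/ℕ-exact b k refl) (/ℕ-exact c k refl)

disc : Tri → ℤ
disc (tri A b C) = b * b - A * C

in-V : ∀ d x → Par x → disc x ≡ d → InV d x
in-V d (tri A b C) (≈₂-intro 2∣A+C) disc≡d =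
  ℤS.∣⇒∣ᵤ (subst (+ 2 ℤS.∣_) (ℤP.+-identityʳ (A + C)) 2∣A+C) , disc≡d

V-Par : ∀ d x → InV d x → Par x
V-Par d (tri A b C) (2∣A+C , _) =
  ≈₂-intro (subst (+ 2 ℤS.∣_) (sym (ℤP.+-identityʳ (A + C))) (ℤS.∣ᵤ⇒∣ 2∣A+C))

V-disc : ∀ d x → InV d x → disc x ≡ d
V-disc d (tri A b C) (_ , disc≡d) = disc≡d

-- The orbit classification for d = n²

module Orbits (n : ℕ) .{{_ : NonZero n}} where

  N : ℤ
  N = + n

  N≢0 : N ≢ + 0
  N≢0 N≡0 = ℕ.≢-nonZero⁻¹ n (ℤP.+-injective N≡0)

  NN≡ : N * N ≡ + (n ℕ.* n)
  NN≡ = sym (ℤP.pos-* n n)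

  Z : ℤ → Tri
  Z c = tri (+ 0) N c

  Z-T : ∀ c u → act (Z c) (T u) ≡ Z (c + + 2 * N * u)
  Z-T c u = cong₃ tri (eA N c) (eb N c u) (eC N c u)
    where
    eA : ∀ N c → + 0 * (+ 1 * + 1) + + 2 * N * (+ 1 * + 0) + c * (+ 0 * + 0) ≡ + 0
    eA = solve-∀
    eb : ∀ N c u → + 0 * (+ 1 * u) + N * (+ 1 * + 1 + u * + 0) + c * (+ 0 * + 1) ≡ N
    eb = solve-∀
    eC : ∀ N c u → + 0 * (u * u) + + 2 * N * (u * + 1) + c * (+ 1 * + 1) ≡ c + + 2 * N * u
    eC = solve-∀

  ZH-γ : ∀ c u → act (act (Z c) H) (γ u) ≡ act (Z (c + + 2 * N * u)) H
  ZH-γ c u = begin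
    act (act (Z c) H) (γ u)    ≡⟨ sym (act-∙ (Z c) H (γ u)) ⟩
    act (Z c) (H ∙ γ u)        ≡⟨ cong (act (Z c)) (H∙γ u) ⟩
    act (Z c) (T u ∙ H)        ≡⟨ act-∙ (Z c) (T u) H ⟩
    act (act (Z c) (T u)) H    ≡⟨ cong (λ y → act y H) (Z-T c u) ⟩
    act (Z (c + + 2 * N * u)) H ∎
    where open ≡-Reasoning

  ZH-formula : ∀ c → act (Z c) H ≡ tri (+ 2 * N + c) (N + c) c
  ZH-formula c = cong₃ tri (eA N c) (eb N c) (eC N c)
    where
    eA : ∀ N c → + 0 * (+ 1 * + 1) + + 2 * N * (+ 1 * + 1) + c * (+ 1 * + 1) ≡ + 2 * N + c
    eA = solve-∀
    eb : ∀ N c → + 0 * (+ 1 * + 0) + N * (+ 1 * + 1 + + 0 * + 1) + c * (+ 1 * + 1) ≡ N + c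
    eb = solve-∀
    eC : ∀ N c → + 0 * (+ 0 * + 0) + + 2 * N * (+ 0 * + 1) + c * (+ 1 * + 1) ≡ c
    eC = solve-∀

  -- Conversely, a matrix of determinant 1 carrying Z c to Z c′ is ±T(u), and
  -- then c′ = c + 2N·(±u).  (If r ≠ 0, the equations a′ = 0, b′ = N force
  -- 2Np + cr = 0 = 2Nq + cs, whence 2N = 2N(ps - qr) = 0.)
  Z-stabiliser : ∀ c c′ g → det g ≡ + 1 → act (Z c) g ≡ Z c′ →
    (M2.r g ≡ + 0) × (M2.p g * M2.s g ≡ + 1) × (c′ ≡ c + + 2 * N * (M2.q g * M2.s g))
  Z-stabiliser c c′ (mat p q r s) det≡1 x^g≡ with r ℤP.≟ + 0
  ... | yes refl =
    refl , ps≡1 , trans (sym C′≡) (C-formula N c q s (unit-square (proj₂ (unit-factors p s ps≡1))))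
    where
    ps≡1 : p * s ≡ + 1
    ps≡1 = trans (det-r0 p q s) det≡1
      where
      det-r0 : ∀ p q s → p * s ≡ p * s - q * + 0
      det-r0 = solve-∀
    C′≡ : + 0 * (q * q) + + 2 * N * (q * s) + c * (s * s) ≡ c′
    C′≡ = cong Tri.C x^g≡
    C-formula : ∀ N c q s → s * s ≡ + 1 →
      + 0 * (q * q) + + 2 * N * (q * s) + c * (s * s) ≡ c + + 2 * N * (q * s)
    C-formula N c q s ss≡1 rewrite ss≡1 = e N c q s
      where
      e : ∀ N c q s → + 0 * (q * q) + + 2 * N * (q * s) + c * + 1 ≡ c + + 2 * N * (q * s)
      e = solve-∀
  ... | no r≢0 = ⊥-elim (N≢0 (cancel-nonzero {N} {+ 2} (λ ()) 2N≡0))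
    where
    u v : ℤ
    u = + 2 * N * p + c * r
    v = + 2 * N * q + c * s
    u≡0 : u ≡ + 0
    u≡0 = cancel-nonzero r≢0 (trans (A′≡ N c p r) (cong Tri.A x^g≡))
      where
      A′≡ : ∀ N c p r → (+ 2 * N * p + c * r) * r ≡ + 0 * (p * p) + + 2 * N * (p * r) + c * (r * r)
      A′≡ = solve-∀
    v≡0 : v ≡ + 0
    v≡0 = cancel-nonzero r≢0 (begin
      v * r                                                          ≡⟨ b′≡ N c p q r s ⟩
      (+ 0 * (p * q) + N * (p * s + q * r) + c * (r * s)) - N
        + N * (+ 1 - (p * s - q * r))
        ≡⟨ cong₂ (λ b′ d → b′ - N + N * (+ 1 - d)) (cong Tri.b x^g≡) det≡1 ⟩
      N - N + N * (+ 1 - + 1)                                         ≡⟨ vanish N ⟩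
      + 0                                                             ∎)
      where
      open ≡-Reasoning
      b′≡ : ∀ N c p q r s → (+ 2 * N * q + c * s) * r
        ≡ (+ 0 * (p * q) + N * (p * s + q * r) + c * (r * s)) - N + N * (+ 1 - (p * s - q * r))
      b′≡ = solve-∀
      vanish : ∀ N → N - N + N * (+ 1 - + 1) ≡ + 0
      vanish = solve-∀
    2N≡0 : N * + 2 ≡ + 0
    2N≡0 = begin
      N * + 2                   ≡⟨ ℤP.*-identityʳ (N * + 2) ⟨
      N * + 2 * + 1             ≡⟨ cong (λ d → N * + 2 * d) det≡1 ⟨
      N * + 2 * (p * s - q * r) ≡⟨ expand N c p q r s ⟩
      s * u - r * v             ≡⟨ cong₂ (λ x y → s * x - r * y) u≡0 v≡0 ⟩
      s * + 0 - r * + 0         ≡⟨ vanish r s ⟩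
      + 0                       ∎
      where
      open ≡-Reasoning
      expand : ∀ N c p q r s → N * + 2 * (p * s - q * r) ≡ s * (+ 2 * N * p + c * r) - r * (+ 2 * N * q + c * s)
      expand = solve-∀
      vanish : ∀ r s → s * + 0 - r * + 0 ≡ + 0
      vanish = solve-∀

  rep-false : ∀ j → rep n false j ≡ Z (+ 2 * + toℕ j)
  rep-false j = trans (divTri-exact _ (n ℕ.* n) {{ℕP.m*n≢0 n n}} 0 n (2 ℕ.* J) scaled)
                      (cong (tri (+ 0) N) (ℤP.pos-* 2 J))
    where
    J = toℕ j
    scaled : act (base n) (τM n J) ≡ tri (+ 0 * + (n ℕ.* n)) (N * + (n ℕ.* n)) (+ (2 ℕ.* J) * + (n ℕ.* n))
    scaled = cong₃ tri (trans (eA N) (cong (+ 0 *_) NN≡)) (trans (eb N (+ J)) (cong (N *_) NN≡))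
                       (trans (eC N (+ J)) (cong₂ _*_ (sym (ℤP.pos-* 2 J)) NN≡))
      where
      eA : ∀ N → + 0 * (N * N) + + 2 * N * (N * + 0) + + 0 * (+ 0 * + 0) ≡ + 0 * (N * N)
      eA = solve-∀
      eb : ∀ N J → + 0 * (N * J) + N * (N * N + J * + 0) + + 0 * (+ 0 * N) ≡ N * (N * N)
      eb = solve-∀
      eC : ∀ N J → + 0 * (J * J) + + 2 * N * (J * N) + + 0 * (N * N) ≡ + 2 * J * (N * N)
      eC = solve-∀

  rep-true : ∀ j → rep n true j ≡ act (Z (+ toℕ j)) H
  rep-true j = begin
    rep n true j
      ≡⟨ divTri-exact _ D {{D≢0}} (2 ℕ.* n ℕ.+ J) (n ℕ.+ J) J scaled ⟩
    tri (+ (2 ℕ.* n ℕ.+ J)) (+ (n ℕ.+ J)) (+ J) ≡⟨ cong₂ (λ a b → tri a b (+ J)) P≡ (ℤP.pos-+ n J) ⟩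
    tri (+ 2 * N + + J) (N + + J) (+ J)          ≡⟨ ZH-formula (+ J) ⟨
    act (Z (+ J)) H                              ∎
    where
    open ≡-Reasoning
    J = toℕ j
    D = 2 ℕ.* n ℕ.* (2 ℕ.* n)
    D≢0 : NonZero D
    D≢0 = ℕP.m*n≢0 (2 ℕ.* n) (2 ℕ.* n) {{ℕP.m*n≢0 2 n}} {{ℕP.m*n≢0 2 n}}
    P R : ℤ
    P = + (2 ℕ.* n ℕ.+ J)
    R = + (2 ℕ.* n)
    R≡ : R ≡ + 2 * N
    R≡ = ℤP.pos-* 2 n
    P≡ : P ≡ + 2 * N + + J
    P≡ = trans (ℤP.pos-+ (2 ℕ.* n) J) (cong (_+ + J) R≡)
    RR : R * R ≡ + D
    RR = sym (ℤP.pos-* (2 ℕ.* n) (2 ℕ.* n))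
    scaled : act (base n) (τ̃M n J) ≡ tri (P * + D) (+ (n ℕ.+ J) * + D) (+ J * + D)
    scaled = cong₃ tri (trans (eA N P R P≡ R≡) (cong (P *_) RR))
                       (trans (eb N (+ J) P R P≡ R≡) (cong₂ _*_ (sym (ℤP.pos-+ n J)) RR))
                       (trans (eC N (+ J) R R≡) (cong (+ J *_) RR))
      where
      eA : ∀ N P R → P ≡ + 2 * N + + J → R ≡ + 2 * N →
        + 0 * (P * P) + + 2 * N * (P * R) + + 0 * (R * R) ≡ P * (R * R)
      eA N _ _ refl refl = e N (+ J)
        where
        e : ∀ N J → + 0 * ((+ 2 * N + J) * (+ 2 * N + J)) + + 2 * N * ((+ 2 * N + J) * (+ 2 * N))
                    + + 0 * (+ 2 * N * (+ 2 * N)) ≡ (+ 2 * N + J) * (+ 2 * N * (+ 2 * N))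
        e = solve-∀
      eb : ∀ N J P R → P ≡ + 2 * N + J → R ≡ + 2 * N →
        + 0 * (P * J) + N * (P * R + J * R) + + 0 * (R * R) ≡ (N + J) * (R * R)
      eb N J _ _ refl refl = e N J
        where
        e : ∀ N J → + 0 * ((+ 2 * N + J) * J) + N * ((+ 2 * N + J) * (+ 2 * N) + J * (+ 2 * N))
                    + + 0 * (+ 2 * N * (+ 2 * N)) ≡ (N + J) * (+ 2 * N * (+ 2 * N))
        e = solve-∀
      eC : ∀ N J R → R ≡ + 2 * N → + 0 * (J * J) + + 2 * N * (J * R) + + 0 * (R * R) ≡ J * (R * R)
      eC N J _ refl = e N J
        where
        e : ∀ N J → + 0 * (J * J) + + 2 * N * (J * (+ 2 * N)) + + 0 * (+ 2 * N * (+ 2 * N))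
                    ≡ J * (+ 2 * N * (+ 2 * N))
        e = solve-∀

  Z-in-V : ∀ c → c ≈₂ + 0 → InV (+ (n ℕ.* n)) (Z c)
  Z-in-V c c≈0 = in-V _ (Z c) (subst (_≈₂ + 0) (sym (ℤP.+-identityˡ c)) c≈0) (trans (disc-Z N c) NN≡)
    where
    disc-Z : ∀ N c → N * N - + 0 * c ≡ N * N
    disc-Z = solve-∀

  ZH-in-V : ∀ c → InV (+ (n ℕ.* n)) (act (Z c) H)
  ZH-in-V c = subst (InV _) (sym (ZH-formula c)) $
    in-V _ (tri (+ 2 * N + c) (N + c) c) (≈₂-intro (ℤS.divides (N + c) (sum-AC N c))) (trans (disc-ZH N c) NN≡)
    where
    sum-AC : ∀ N c → + 2 * N + c + c - + 0 ≡ (N + c) * + 2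
    sum-AC = solve-∀
    disc-ZH : ∀ N c → (N + c) * (N + c) - (+ 2 * N + c) * c ≡ N * N
    disc-ZH = solve-∀

  rep-in-V : ∀ k j → InV (+ (n ℕ.* n)) (rep n k j)
  rep-in-V false j = subst (InV _) (sym (rep-false j)) (Z-in-V _ (even (+ toℕ j)))
  rep-in-V true j = subst (InV _) (sym (rep-true j)) (ZH-in-V (+ toℕ j))

  -- Existence.  On Ṽ_{n²} the matrix [[A, b+N], [b-N, C]] is singular
  -- (its determinant is N² - (b² - AC)); we follow a nonzero kernel vector.
  Kernel : Tri → ℤ² → Set
  Kernel (tri A b C) (u , v) = (A * u + (b + N) * v ≡ + 0) × ((b - N) * u + C * v ≡ + 0)

  Kernel-act : ∀ x g w → det g ≡ + 1 → Kernel x (g ⊙ w) → Kernel (act x g) w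
  Kernel-act (tri A b C) (mat p q r s) (w₁ , w₂) det≡1 (k₁ , k₂) =
    trans (row₁ N A b C p q r s w₁ w₂) (trans (cong₃ combine₁ k₁ k₂ det≡1) (vanish₁ N p r w₂)) ,
    trans (row₂ N A b C p q r s w₁ w₂) (trans (cong₃ combine₂ k₁ k₂ det≡1) (vanish₂ N q s w₁))
    where
    -- each new row is a combination of the old rows plus a multiple of 1 - det g
    combine₁ combine₂ : ℤ → ℤ → ℤ → ℤ
    combine₁ e₁ e₂ d = p * e₁ + r * e₂ + N * (+ 1 - d) * w₂
    combine₂ e₁ e₂ d = q * e₁ + s * e₂ - N * (+ 1 - d) * w₁
    row₁ : ∀ N A b C p q r s w₁ w₂ →
      (A * (p * p) + + 2 * b * (p * r) + C * (r * r)) * w₁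
      + ((A * (p * q) + b * (p * s + q * r) + C * (r * s)) + N) * w₂
      ≡ p * (A * (p * w₁ + q * w₂) + (b + N) * (r * w₁ + s * w₂))
        + r * ((b - N) * (p * w₁ + q * w₂) + C * (r * w₁ + s * w₂))
        + N * (+ 1 - (p * s - q * r)) * w₂
    row₁ = solve-∀
    row₂ : ∀ N A b C p q r s w₁ w₂ →
      ((A * (p * q) + b * (p * s + q * r) + C * (r * s)) - N) * w₁
      + (A * (q * q) + + 2 * b * (q * s) + C * (s * s)) * w₂
      ≡ q * (A * (p * w₁ + q * w₂) + (b + N) * (r * w₁ + s * w₂))
        + s * ((b - N) * (p * w₁ + q * w₂) + C * (r * w₁ + s * w₂))
        - N * (+ 1 - (p * s - q * r)) * w₁
    row₂ = solve-∀
    vanish₁ : ∀ N p r w₂ → p * + 0 + r * + 0 + N * (+ 1 - + 1) * w₂ ≡ + 0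
    vanish₁ = solve-∀
    vanish₂ : ∀ N q s w₁ → q * + 0 + s * + 0 - N * (+ 1 - + 1) * w₁ ≡ + 0
    vanish₂ = solve-∀

  Kernel-neg : ∀ x u v → Kernel x (u , v) → Kernel x (- u , - v)
  Kernel-neg (tri A b C) u v (k₁ , k₂) = trans (e₁ N A b u v) (cong -_ k₁) , trans (e₂ N b C u v) (cong -_ k₂)
    where
    e₁ : ∀ N A b u v → A * (- u) + (b + N) * (- v) ≡ - (A * u + (b + N) * v)
    e₁ = solve-∀
    e₂ : ∀ N b C u v → (b - N) * (- u) + C * (- v) ≡ - ((b - N) * u + C * v)
    e₂ = solve-∀

  -- (-(b+N), A) and (C, N-b) are kernel vectors; they cannot both vanish.
  kernel-vector : ∀ x → disc x ≡ N * N → Σ ℤ² λ w → Kernel x w × w ≢ (+ 0 , + 0)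
  kernel-vector (tri A b C) disc≡ with ≡-dec ℤP._≟_ ℤP._≟_ (- (b + N) , A) (+ 0 , + 0)
  ... | no w₁≢0 = (- (b + N) , A) , (col₁ N A b , trans (col₂ N A b C) N²-disc) , w₁≢0
    where
    col₁ : ∀ N A b → A * (- (b + N)) + (b + N) * A ≡ + 0
    col₁ = solve-∀
    col₂ : ∀ N A b C → (b - N) * (- (b + N)) + C * A ≡ N * N - (b * b - A * C)
    col₂ = solve-∀
    N²-disc : N * N - (b * b - A * C) ≡ + 0
    N²-disc = trans (cong (λ z → N * N - z) disc≡) (ℤP.+-inverseʳ (N * N))
  ... | yes w₁≡0 = (C , N - b) , (trans (col₁ N A b C) N²-disc , col₂ N b C) , w₂≢0
    where
    col₁ : ∀ N A b C → A * C + (b + N) * (N - b) ≡ N * N - (b * b - A * C)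
    col₁ = solve-∀
    col₂ : ∀ N b C → (b - N) * C + C * (N - b) ≡ + 0
    col₂ = solve-∀
    N²-disc : N * N - (b * b - A * C) ≡ + 0
    N²-disc = trans (cong (λ z → N * N - z) disc≡) (ℤP.+-inverseʳ (N * N))
    -- b = -N, so the second coordinate N - b = 2N is nonzero.
    w₂≢0 : (C , N - b) ≢ (+ 0 , + 0)
    w₂≢0 w₂≡0 = N≢0 (cancel-nonzero {N} {+ 2} (λ ()) (begin
      N * + 2               ≡⟨ split N b ⟩
      (N - b) - (- (b + N)) ≡⟨ cong₂ _-_ (cong proj₂ w₂≡0) (cong proj₁ w₁≡0) ⟩
      + 0                   ∎))
      where
      open ≡-Reasoning
      split : ∀ N b → N * + 2 ≡ (N - b) - (- (b + N))
      split = solve-∀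

  Res : Tri → Set
  Res x = Σ Bool λ k → Σ (Fin (2 ℕ.* n)) λ j → x ∼ rep n k j

  Res-back : ∀ x g → InΓ₂ g → Res (act x g) → Res x
  Res-back x g γ (k , j , x^g∼rep) = k , j , ∼-trans {x} {act x g} (g , γ , refl) x^g∼rep

  divide-2N : ∀ c → Σ (Fin (2 ℕ.* n)) λ j → Σ ℤ λ t → c ≡ + toℕ j + + 2 * N * t
  divide-2N c = fromℕ< r<2n , q , (begin
    c                          ≡⟨ ℤD.a≡a%ℕn+[a/ℕn]*n c (2 ℕ.* n) ⟩
    + r + q * + (2 ℕ.* n)      ≡⟨ cong₂ (λ a b → + a + q * b) (sym (FinP.toℕ-fromℕ< r<2n)) (ℤP.pos-* 2 n) ⟩
    + toℕ (fromℕ< r<2n) + q * (+ 2 * N) ≡⟨ cong (λ z → + toℕ (fromℕ< r<2n) + z) (ℤP.*-comm q (+ 2 * N)) ⟩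
    + toℕ (fromℕ< r<2n) + + 2 * N * q ∎)
    where
    open ≡-Reasoning
    instance
      2n≢0 : NonZero (2 ℕ.* n)
      2n≢0 = ℕP.m*n≢0 2 n
    r : ℕ
    r = c %ℕ (2 ℕ.* n)
    q : ℤ
    q = c /ℕ (2 ℕ.* n)
    r<2n : r ℕ.< 2 ℕ.* n
    r<2n = ℤD.n%ℕd<d c (2 ℕ.* n)

  Z-Res : ∀ c → c ≈₂ + 0 → Res (Z c)
  Z-Res c (≈₂-intro (ℤS.divides c₂ c-0≡)) with divide-2N c₂
  ... | j , t , c₂≡ = false , j , T (+ 2 * - t) , T-Γ₂ _ (even (- t)) , (begin
    act (Z c) (T (+ 2 * - t))         ≡⟨ Z-T c (+ 2 * - t) ⟩
    Z (c + + 2 * N * (+ 2 * - t))     ≡⟨ cong (λ z → Z (z + + 2 * N * (+ 2 * - t))) c≡ ⟩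
    Z (c₂ * + 2 + + 2 * N * (+ 2 * - t)) ≡⟨ cong (λ z → Z (z * + 2 + + 2 * N * (+ 2 * - t))) c₂≡ ⟩
    Z ((+ J + + 2 * N * t) * + 2 + + 2 * N * (+ 2 * - t)) ≡⟨ cong Z (cancel N (+ J) t) ⟩
    Z (+ 2 * + J)                     ≡⟨ rep-false j ⟨
    rep n false j                     ∎)
    where
    open ≡-Reasoning
    J = toℕ j
    c≡ : c ≡ c₂ * + 2
    c≡ = trans (sym (ℤP.+-identityʳ c)) c-0≡
    cancel : ∀ N J t → (J + + 2 * N * t) * + 2 + + 2 * N * (+ 2 * - t) ≡ + 2 * J
    cancel = solve-∀

  ZH-Res : ∀ c → Res (act (Z c) H)
  ZH-Res c with divide-2N c
  ... | j , t , c≡ = true , j , γ (- t) , γ-Γ₂ (- t) , (begin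
    act (act (Z c) H) (γ (- t))        ≡⟨ ZH-γ c (- t) ⟩
    act (Z (c + + 2 * N * - t)) H      ≡⟨ cong (λ z → act (Z (z + + 2 * N * - t)) H) c≡ ⟩
    act (Z (+ J + + 2 * N * t + + 2 * N * - t)) H ≡⟨ cong (λ z → act (Z z) H) (cancel N (+ J) t) ⟩
    act (Z (+ J)) H                    ≡⟨ rep-true j ⟨
    rep n true j                       ∎)
    where
    open ≡-Reasoning
    J = toℕ j
    cancel : ∀ N J t → J + + 2 * N * t + + 2 * N * - t ≡ J
    cancel = solve-∀

  terminal-Res : ∀ x w → Par x → Kernel x w → Terminal w → Res x
  terminal-Res (tri A b C) (u , + 0) par (k₁ , k₂) (horizontal u≢0) = subst Res (sym x≡Z) (Z-Res C C≈0)
    where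
    A≡0 : A ≡ + 0
    A≡0 = cancel-nonzero u≢0 (trans (e₁ N A b u) k₁)
      where
      e₁ : ∀ N A b u → A * u ≡ A * u + (b + N) * + 0
      e₁ = solve-∀
    b≡N : b ≡ N
    b≡N = ℤP.i-j≡0⇒i≡j b N (cancel-nonzero u≢0 (trans (e₂ N b C u) k₂))
      where
      e₂ : ∀ N b C u → (b - N) * u ≡ (b - N) * u + C * + 0
      e₂ = solve-∀
    C≈0 : C ≈₂ + 0
    C≈0 = subst (_≈₂ + 0) (trans (cong (_+ C) A≡0) (ℤP.+-identityˡ C)) par
    x≡Z : tri A b C ≡ Z C
    x≡Z = cong₃ tri A≡0 b≡N refl
  terminal-Res (tri A b C) (.(- v) , v) par (k₁ , k₂) (antidiagonal {v} v≢0) =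
    subst Res (sym x≡ZH) (ZH-Res (b - N))
    where
    A≡ : A ≡ b + N
    A≡ = sym (ℤP.i-j≡0⇒i≡j (b + N) A (cancel-nonzero v≢0 (trans (e₁ N A b v) k₁)))
      where
      e₁ : ∀ N A b v → (b + N - A) * v ≡ A * (- v) + (b + N) * v
      e₁ = solve-∀
    C≡ : C ≡ b - N
    C≡ = ℤP.i-j≡0⇒i≡j C (b - N) (cancel-nonzero v≢0 (trans (e₂ N b C v) k₂))
      where
      e₂ : ∀ N b C v → (C - (b - N)) * v ≡ (b - N) * (- v) + C * v
      e₂ = solve-∀
    x≡ZH : tri A b C ≡ act (Z (b - N)) H
    x≡ZH = trans (cong₃ tri (trans A≡ (e₃ N b)) (e₄ N b) C≡) (sym (ZH-formula (b - N)))
      where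
      e₃ : ∀ N b → b + N ≡ + 2 * N + (b - N)
      e₃ = solve-∀
      e₄ : ∀ N b → b ≡ N + (b - N)
      e₄ = solve-∀

  -- The descent, with fuel f bounding the size of the kernel vector.
  mutual
    descend : ∀ f x w → Par x → Kernel x w → w ≢ (+ 0 , + 0) → size w ℕ.< f → Res x
    descend (suc f) x (u , + 0) par k w≢0 _ =
      terminal-Res x (u , + 0) par k (horizontal (λ u≡0 → w≢0 (cong (_, + 0) u≡0)))
    descend (suc f) x (u , + suc m) par k _ lt = descend⁺ f x u m par k lt
    descend (suc f) x (u , -[1+ m ]) par k _ lt =
      descend⁺ f x (- u) m par (Kernel-neg x u -[1+ m ] k) (subst (ℕ._< suc f) (sym (size-neg u (+ suc m))) lt)

    descend⁺ : ∀ f x u m → Par x → Kernel x (u , + suc m) → size (u , + suc m) ℕ.< suc f → Res x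
    descend⁺ f x u m par k lt with reduce⁺ u m
    ... | inj₁ terminal = terminal-Res x (u , + suc m) par k terminal
    ... | inj₂ (reduction g g∈Γ₂ w′ g⊙w′≡w progress) = Res-back x g g∈Γ₂ (continue progress)
      where
      par′ : Par (act x g)
      par′ = Par-act x g g∈Γ₂ par
      k′ : Kernel (act x g) w′
      k′ = Kernel-act x g w′ (proj₁ g∈Γ₂) (subst (Kernel x) (sym g⊙w′≡w) k)
      w′≢0 : w′ ≢ (+ 0 , + 0)
      w′≢0 w′≡0 with cong proj₂ (trans (sym g⊙w′≡w) (trans (cong (g ⊙_) w′≡0) (⊙-zero g)))
      ... | ()
      continue : Terminal w′ ⊎ size w′ ℕ.< size (u , + suc m) → Res (act x g)
      continue (inj₁ terminal) = terminal-Res (act x g) w′ par′ k′ terminal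
      continue (inj₂ smaller) = descend f (act x g) w′ par′ k′ w′≢0 (ℕP.<-≤-trans smaller (ℕ.s≤s⁻¹ lt))

  existence : ∀ x → InV (+ (n ℕ.* n)) x → Res x
  existence x x∈V with kernel-vector x (trans (V-disc _ x x∈V) (sym NN≡))
  ... | w , k , w≢0 = descend (suc (size w)) x w (V-Par _ x x∈V) k w≢0 (ℕP.n<1+n (size w))

  Z-Γ₂-stabiliser : ∀ c c′ g → InΓ₂ g → act (Z c) g ≡ Z c′ → Σ ℤ λ t → c′ ≡ c + + 2 * N * (+ 2 * t)
  Z-Γ₂-stabiliser c c′ (mat p q r s) γ x^g≡ with Z-stabiliser c c′ (mat p q r s) (proj₁ γ) x^g≡
  ... | r≡0 , _ , c′≡ with Γ₂-r-even p q r s γ (≈₂-reflexive r≡0)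
  ... | ≈₂-intro (ℤS.divides q₂ q-0≡) =
    q₂ * s , trans c′≡ (trans (cong (λ z → c + + 2 * N * (z * s)) q≡) (regroup N c q₂ s))
    where
    q≡ : q ≡ q₂ * + 2
    q≡ = trans (sym (ℤP.+-identityʳ q)) q-0≡
    regroup : ∀ N c q₂ s → c + + 2 * N * (q₂ * + 2 * s) ≡ c + + 2 * N * (+ 2 * (q₂ * s))
    regroup = solve-∀

  ZH-stabiliser : ∀ c c′ g → det g ≡ + 1 → act (act (Z c) H) g ≡ act (Z c′) H →
    Σ ℤ λ t → c′ ≡ c + + 2 * N * t
  ZH-stabiliser c c′ g det≡1 x^g≡ = M2.q δ * M2.s δ , proj₂ (proj₂ (Z-stabiliser c c′ δ det-δ Z^δ≡))
    where
    open ≡-Reasoning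
    δ : M2
    δ = H ∙ g ∙ H⁻¹
    det-δ : det δ ≡ + 1
    det-δ = trans (det-∙ (H ∙ g) H⁻¹) (cong (_* det H⁻¹) (trans (det-∙ H g) (cong (det H *_) det≡1)))
    Z^δ≡ : act (Z c) δ ≡ Z c′
    Z^δ≡ = begin
      act (Z c) (H ∙ g ∙ H⁻¹)       ≡⟨ act-∙ (Z c) (H ∙ g) H⁻¹ ⟩
      act (act (Z c) (H ∙ g)) H⁻¹   ≡⟨ cong (λ y → act y H⁻¹) (act-∙ (Z c) H g) ⟩
      act (act (act (Z c) H) g) H⁻¹ ≡⟨ cong (λ y → act y H⁻¹) x^g≡ ⟩
      act (act (Z c′) H) H⁻¹        ≡⟨ act-H-H⁻¹ (Z c′) ⟩
      Z c′                          ∎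

  -- The two families are never Γ₂-equivalent: a matrix relating them would be
  -- ±T(u)H or H⁻¹(±T(u)), whose lower row resp. first column is odd — impossible in Γ₂.
  Z≁ZH : ∀ c c′ g → InΓ₂ g → act (Z c) g ≡ act (Z c′) H → ⊥
  Z≁ZH c c′ g@(mat p q r s) γ x^g≡ = unit-odd s-unit (proj₂ (Γ₂-r-odd p q r s γ r-odd))
    where
    δ : M2
    δ = g ∙ H⁻¹
    det-δ : det δ ≡ + 1
    det-δ = trans (det-∙ g H⁻¹) (cong (_* det H⁻¹) (proj₁ γ))
    Z^δ≡ : act (Z c) δ ≡ Z c′
    Z^δ≡ = trans (act-∙ (Z c) g H⁻¹) (trans (cong (λ y → act y H⁻¹) x^g≡) (act-H-H⁻¹ (Z c′)))
    stab = Z-stabiliser c c′ δ det-δ Z^δ≡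
    s-unit : IsUnit s
    s-unit = subst IsUnit (e₁ r s) (proj₂ (unit-factors (M2.p δ) (M2.s δ) (proj₁ (proj₂ stab))))
      where
      e₁ : ∀ r s → r * + 0 + s * + 1 ≡ s
      e₁ = solve-∀
    r-odd : Odd r
    r-odd = subst Odd (sym (ℤP.i-j≡0⇒i≡j r s (trans (e₂ r s) (proj₁ stab)))) (unit-odd s-unit)
      where
      e₂ : ∀ r s → r - s ≡ r * + 1 + s * - + 1
      e₂ = solve-∀

  ZH≁Z : ∀ c c′ g → InΓ₂ g → act (act (Z c) H) g ≡ Z c′ → ⊥
  ZH≁Z c c′ g@(mat p q r s) γ x^g≡ = unit-odd p-unit (proj₁ (Γ₂-r-odd p q r s γ r-odd))
    where
    δ : M2
    δ = H ∙ g
    det-δ : det δ ≡ + 1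
    det-δ = trans (det-∙ H g) (cong (det H *_) (proj₁ γ))
    stab = Z-stabiliser c c′ δ det-δ (trans (act-∙ (Z c) H g) x^g≡)
    p-unit : IsUnit p
    p-unit = subst IsUnit (e₁ p r) (proj₁ (unit-factors (M2.p δ) (M2.s δ) (proj₁ (proj₂ stab))))
      where
      e₁ : ∀ p r → + 1 * p + + 0 * r ≡ p
      e₁ = solve-∀
    r-odd : Odd r
    r-odd = subst Odd (sym r≡-p) (unit-odd (unit-neg p-unit))
      where
      e₂ : ∀ p r → r ≡ - p + (+ 1 * p + + 1 * r)
      e₂ = solve-∀
      r≡-p : r ≡ - p
      r≡-p = trans (e₂ p r) (trans (cong (λ z → - p + z) (proj₁ stab)) (ℤP.+-identityʳ (- p)))

  same-index : ∀ (j j′ : Fin (2 ℕ.* n)) t → + toℕ j′ ≡ + toℕ j + + 2 * N * t → j′ ≡ j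
  same-index j j′ t j′≡ = FinP.toℕ-injective (residue-unique (FinP.toℕ<n j) (FinP.toℕ<n j′) t
    (trans j′≡ (cong (λ D → + toℕ j + D * t) (sym (ℤP.pos-* 2 n)))))

  act-≡ : ∀ {x x′ y y′} g → x ≡ x′ → y ≡ y′ → act x g ≡ y → act x′ g ≡ y′
  act-≡ g refl refl x^g≡y = x^g≡y

  false-unique : ∀ j j′ → rep n false j ∼ rep n false j′ → j′ ≡ j
  false-unique j j′ (g , γ , x^g≡) =
    same-index j j′ t (ℤP.*-cancelˡ-≡ (+ 2) (+ toℕ j′) (+ toℕ j + + 2 * N * t)
                                       (trans 2j′≡ (halve N (+ toℕ j) t)))
    where
    stab = Z-Γ₂-stabiliser (+ 2 * + toℕ j) (+ 2 * + toℕ j′) g γ (act-≡ g (rep-false j) (rep-false j′) x^g≡)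
    t : ℤ
    t = proj₁ stab
    2j′≡ : + 2 * + toℕ j′ ≡ + 2 * + toℕ j + + 2 * N * (+ 2 * t)
    2j′≡ = proj₂ stab
    halve : ∀ N J t → + 2 * J + + 2 * N * (+ 2 * t) ≡ + 2 * (J + + 2 * N * t)
    halve = solve-∀

  true-unique : ∀ j j′ → rep n true j ∼ rep n true j′ → j′ ≡ j
  true-unique j j′ (g , γ , x^g≡) = same-index j j′ (proj₁ stab) (proj₂ stab)
    where
    stab = ZH-stabiliser (+ toℕ j) (+ toℕ j′) g (proj₁ γ) (act-≡ g (rep-true j) (rep-true j′) x^g≡)

  false≁true : ∀ j j′ → rep n false j ∼ rep n true j′ → ⊥
  false≁true j j′ (g , γ , x^g≡) =
    Z≁ZH (+ 2 * + toℕ j) (+ toℕ j′) g γ (act-≡ g (rep-false j) (rep-true j′) x^g≡)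

  true≁false : ∀ j j′ → rep n true j ∼ rep n false j′ → ⊥
  true≁false j j′ (g , γ , x^g≡) =
    ZH≁Z (+ toℕ j) (+ 2 * + toℕ j′) g γ (act-≡ g (rep-true j) (rep-false j′) x^g≡)

  rep-unique : ∀ k k′ j j′ → rep n k j ∼ rep n k′ j′ → rep n k j ≡ rep n k′ j′
  rep-unique false false j j′ e = cong (rep n false) (sym (false-unique j j′ e))
  rep-unique true  true  j j′ e = cong (rep n true) (sym (true-unique j j′ e))
  rep-unique false true  j j′ e = ⊥-elim (false≁true j j′ e)
  rep-unique true  false j j′ e = ⊥-elim (true≁false j j′ e)

lemma6p2 : (n : ℕ) .{{_ : NonZero n}} →
    ((k : Bool) (j : Fin (2 ℕ.* n)) → InV (+ (n ℕ.* n)) (rep n k j)) ×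
    ((x : Tri) → InV (+ (n ℕ.* n)) x →
      Σ Bool λ k → Σ (Fin (2 ℕ.* n)) λ j → x ∼ rep n k j) ×
    ((k k′ : Bool) (j j′ : Fin (2 ℕ.* n)) →
      rep n k j ∼ rep n k′ j′ → rep n k j ≡ rep n k′ j′)
lemma6p2 n = Orbits.rep-in-V n , Orbits.existence n , Orbits.rep-unique n
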